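{- Let $G$ be a $2$-permutable graph. Then $\chi_i(G\,\square\,K_2)=\Delta(G\,\square\,K_2)+1$.
   Context: All graphs are finite and simple. $K^-_{2n}$ is the complete graph on $2n$ vertices with a perfect matching removed. A homomorphism $f:G\to H$ is a map $V(G)\to V(H)$ with $f(u)f(v)\in E(H)$ whenever $uv\in E(G)$; it is locally injective if for every vertex $v$, $f$ is injective on $N(v)$. A connected $2d$-regular graph $G$ is $2$-permutable if it admits a locally injective homomorphism to $K^-_{2d+2}$. An incidence of $G$ is a pair $(v,e)$ with $v\in e\in E(G)$; incidences $(v,e),(u,f)$ are adjacent if $v=u$, or $e=f$, or $vu\in\{e,f\}$; an incidence coloring gives adjacent incidences distinct colors; $\chi_i(G)$ is the least number of colors of an incidence coloring. $\Delta$ denotes maximum degree. $G\,\square\,H$ is the Cartesian product: vertex set $V(G)\times V(H)$, $(u,v)\sim(u',v')$ iff ($uu'\in E(G)$, $v=v'$) or ($u=u'$, $vv'\in E(H)$). -}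

module Defs where

open import Data.Fin using (Fin)
open import Data.Fin.Properties as Fin using (*↔×; inj⇒≟)
open import Data.List using (List; allFin; filter; length; map)
open import Data.List.Extrema.Nat using (max)
open import Data.Nat using (ℕ; suc; _*_; _≤_)
open import Data.Product using (_×_; _,_; proj₁; proj₂; ∃-syntax)
open import Data.Product.Function.NonDependent.Propositional using (_×-↔_)
open import Data.Sum as Sum using (_⊎_)
open import Function using (_∘_; _↔_; Inverse)
open import Function.Properties.Inverse using (↔-refl; ↔-sym; ↔-trans; ↔⇒↣)
open import Relation.Binary using (Decidable; DecidableEquality; Irreflexive; Symmetric)
open import Relation.Binary.Construct.Closure.ReflexiveTransitive using (Star)
open import Relation.Binary.PropositionalEquality using (_≡_; _≢_; refl; sym)
open import Relation.Nullary using (¬_)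
open import Relation.Nullary.Decidable using (¬?; _×-dec_; _⊎-dec_)

record Graph : Set₁ where
  field
    V          : Set
    order      : ℕ
    finite     : V ↔ Fin order
    Adj        : V → V → Set
    adj?       : Decidable Adj
    adj-sym    : Symmetric Adj
    adj-irrefl : Irreflexive _≡_ Adj

  _≟_ : DecidableEquality V
  _≟_ = inj⇒≟ (↔⇒↣ finite)

  vertices : List V
  vertices = map (Inverse.from finite) (allFin order)

  degree : V → ℕ
  degree v = length (filter (adj? v) vertices)

open Graph using (V)

-- The base value 0 matters only for the graph with no vertices.
Δ : Graph → ℕ
Δ G = max 0 (map degree vertices)
  where open Graph G

Regular : ℕ → Graph → Set
Regular k G = ∀ v → degree v ≡ k
  where open Graph G

-- The first component excludes the graph with no vertices.
Connected : Graph → Set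
Connected G = V G × (∀ u v → Star Adj u v)
  where open Graph G

K : ℕ → Graph
K n = record
  { V          = Fin n
  ; order      = n
  ; finite     = ↔-refl
  ; Adj        = _≢_
  ; adj?       = λ u v → ¬? (u Fin.≟ v)
  ; adj-sym    = λ u≢v → u≢v ∘ sym
  ; adj-irrefl = λ u≡v u≢v → u≢v u≡v
  }

-- On the vertex set Fin n × Fin 2, the perfect matching joins (i , 0) to (i , 1).
Matched : ∀ {n} → Fin n × Fin 2 → Fin n × Fin 2 → Set
Matched (i , a) (j , b) = i ≡ j × a ≢ b

-- The complete graph on 2n vertices with a perfect matching removed; note that
-- the argument is n, half the number of vertices.
K⁻2* : ℕ → Graph
K⁻2* n = record
  { V          = Fin n × Fin 2
  ; order      = n * 2
  ; finite     = fin
  ; Adj        = λ u v → u ≢ v × ¬ Matched u v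
  ; adj?       = λ u v → ¬? (inj⇒≟ (↔⇒↣ fin) u v)
                   ×-dec ¬? ((proj₁ u Fin.≟ proj₁ v) ×-dec ¬? (proj₂ u Fin.≟ proj₂ v))
  ; adj-sym    = λ (u≢v , ¬m) → u≢v ∘ sym , λ (i≡j , a≢b) → ¬m (sym i≡j , a≢b ∘ sym)
  ; adj-irrefl = λ u≡v (u≢v , _) → u≢v u≡v
  }
  where
  fin : (Fin n × Fin 2) ↔ Fin (n * 2)
  fin = ↔-sym *↔×

infixl 7 _□_

_□_ : Graph → Graph → Graph
G □ H = record
  { V          = G.V × H.V
  ; order      = G.order * H.order
  ; finite     = ↔-trans (G.finite ×-↔ H.finite) (↔-sym *↔×)
  ; Adj        = λ (u , v) (u′ , v′) → (G.Adj u u′ × v ≡ v′) ⊎ (u ≡ u′ × H.Adj v v′)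
  ; adj?       = λ (u , v) (u′ , v′) →
                   (G.adj? u u′ ×-dec (v H.≟ v′)) ⊎-dec ((u G.≟ u′) ×-dec H.adj? v v′)
  ; adj-sym    = Sum.map (λ (a , e) → G.adj-sym a , sym e) (λ (e , a) → sym e , H.adj-sym a)
  ; adj-irrefl = λ { refl → Sum.[ (λ (a , _) → G.adj-irrefl refl a)
                                , (λ (_ , a) → H.adj-irrefl refl a) ] }
  }
  where
  module G = Graph G
  module H = Graph H

IsHomomorphism : (G H : Graph) → (V G → V H) → Set
IsHomomorphism G H f = ∀ {u v} → G.Adj u v → H.Adj (f u) (f v)
  where
  module G = Graph G
  module H = Graph H

LocallyInjective : (G H : Graph) → (V G → V H) → Set
LocallyInjective G H f = ∀ v {u w} → Adj v u → Adj v w → f u ≡ f w → u ≡ w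
  where open Graph G

-- The target has 2d + 2 = 2(d + 1) vertices.
TwoPermutable : Graph → Set
TwoPermutable G = ∃[ d ]
  Connected G ×
  Regular (2 * d) G ×
  ∃[ f ] IsHomomorphism G (K⁻2* (suc d)) f × LocallyInjective G (K⁻2* (suc d)) f

infix 4 _≈ₚ_

-- Equality of the unordered pairs {a , b} and {c , d}.
_≈ₚ_ : {A : Set} → A × A → A × A → Set
(a , b) ≈ₚ (c , d) = (a ≡ c × b ≡ d) ⊎ (a ≡ d × b ≡ c)

module _ (G : Graph) where
  open Graph G using (Adj)

  -- An edge is an unordered pair of adjacent vertices, so edges are compared
  -- by _≈ₑ_, which ignores the order of the ends and the adjacency proof.
  record Edge : Set where
    field
      ends     : V G × V G
      adjacent : Adj (proj₁ ends) (proj₂ ends)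

  -- Likewise, incidences are compared by _≈ᵢ_.
  record Incidence : Set where
    field
      vertex   : V G
      edge     : Edge
      incident : vertex ≡ proj₁ (Edge.ends edge) ⊎ vertex ≡ proj₂ (Edge.ends edge)

module _ {G : Graph} where
  open Edge
  open Incidence

  infix 4 _≈ₑ_ _≈ᵢ_

  _≈ₑ_ : Edge G → Edge G → Set
  e ≈ₑ f = ends e ≈ₚ ends f

  _≈ᵢ_ : Incidence G → Incidence G → Set
  i ≈ᵢ j = vertex i ≡ vertex j × edge i ≈ₑ edge j

  -- Adjacency relates distinct incidences; without the first component every
  -- incidence would be adjacent to itself.
  AdjacentIncidences : Incidence G → Incidence G → Set
  AdjacentIncidences i j =
    ¬ (i ≈ᵢ j) ×
    ( vertex i ≡ vertex j
    ⊎ edge i ≈ₑ edge j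
    ⊎ ((vertex i , vertex j) ≈ₚ ends (edge i) ⊎ (vertex i , vertex j) ≈ₚ ends (edge j)))

record IncidenceColoring (G : Graph) (k : ℕ) : Set where
  field
    color  : Incidence G → Fin k
    cong   : ∀ {i j} → i ≈ᵢ j → color i ≡ color j
    proper : ∀ {i j} → AdjacentIncidences i j → color i ≢ color j

-- The relation χᵢ(G) = k.
IsIncidenceChromaticNumber : Graph → ℕ → Set
IsIncidenceChromaticNumber G k =
  IncidenceColoring G k × (∀ m → IncidenceColoring G m → k ≤ m)

{-# OPTIONS --safe #-}

-- If closed neighbourhoods of a graph are rainbow under a vertex colouring c, then
-- giving the incidence (v , vu) the colour c u is an incidence colouring.  For G □ K₂
-- such a c is built from f : G → K⁻ by using f on one copy of G and the matching
-- partner of f on the other: the closed neighbourhood of v in G misses exactly the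
-- partner of f v, which is the colour of the new neighbour.  Conversely, the incidences
-- at v together with one incidence entering v are pairwise adjacent, so that
-- Δ + 1 colours are always needed.

module Submission where

open import Defs
open import Data.Fin using (Fin; zero; suc; combine; inject≤; opposite)
open import Data.Fin.Properties using (_≟_; combine-injective; inject≤-injective; injective⇒≤)
open import Data.List using (List; filter; lookup)
open import Data.List.Extrema.Nat using (max<v⁺; xs≤max)
open import Data.List.Membership.Propositional using (_∈_)
open import Data.List.Membership.Propositional.Properties using (∈-allFin; ∈-filter⁺; ∈-filter⁻; ∈-lookup; ∈-map⁺)
open import Data.List.Membership.Setoid.Properties using (index-injective)
open import Data.List.Relation.Unary.All as All using ()
open import Data.List.Relation.Unary.All.Properties as All using ()
open import Data.List.Relation.Unary.AllPairs using (_∷_)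
open import Data.List.Relation.Unary.Any using (index)
open import Data.List.Relation.Unary.Unique.Propositional using (Unique)
open import Data.List.Relation.Unary.Unique.Propositional.Properties using (allFin⁺; filter⁺; map⁺)
open import Data.Nat using (ℕ; suc; _+_; _*_; _≤_; _<_; z≤n; s≤s)
open import Data.Nat.Properties using (+-comm; *-comm; ≤-trans; module ≤-Reasoning)
open import Data.Product using (_×_; _,_; proj₁; proj₂)
open import Data.Product.Properties using (,-injectiveˡ; ×-≡,≡→≡)
open import Data.Sum using (inj₁; inj₂)
open import Function using (_∘_; Inverse; Injective)
open import Function.Properties.Inverse using (↔-sym; ↔⇒↣)
open import Function.Bundles using (Injection)
open import Relation.Binary.PropositionalEquality using (_≡_; _≢_; refl; sym; trans; cong; subst; setoid)
open import Relation.Nullary using (yes; no; contradiction)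

open Graph using (V)

-- Lists without repetition and unordered pairs.

Unique⇒lookup-injective : {A : Set} {xs : List A} → Unique xs → Injective _≡_ _≡_ (lookup xs)
Unique⇒lookup-injective (_ ∷ _)  {zero}  {zero}  _  = refl
Unique⇒lookup-injective (x∉ ∷ _) {zero}  {suc j} eq = contradiction eq (All.lookup x∉ (∈-lookup j))
Unique⇒lookup-injective (x∉ ∷ _) {suc i} {zero}  eq = contradiction (sym eq) (All.lookup x∉ (∈-lookup i))
Unique⇒lookup-injective (_ ∷ u)  {suc i} {suc j} eq = cong suc (Unique⇒lookup-injective u eq)

module _ {A : Set} where

  ≈ₚ-sym : {p q : A × A} → p ≈ₚ q → q ≈ₚ p
  ≈ₚ-sym (inj₁ (refl , refl)) = inj₁ (refl , refl)
  ≈ₚ-sym (inj₂ (refl , refl)) = inj₂ (refl , refl)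

  ≈ₚ-trans : {p q r : A × A} → p ≈ₚ q → q ≈ₚ r → p ≈ₚ r
  ≈ₚ-trans (inj₁ (refl , refl)) q≈r                  = q≈r
  ≈ₚ-trans (inj₂ (refl , refl)) (inj₁ (refl , refl)) = inj₂ (refl , refl)
  ≈ₚ-trans (inj₂ (refl , refl)) (inj₂ (refl , refl)) = inj₁ (refl , refl)

  ≈ₚ-cancelˡ : {a b c : A} → (a , b) ≈ₚ (a , c) → b ≡ c
  ≈ₚ-cancelˡ (inj₁ (_ , refl))    = refl
  ≈ₚ-cancelˡ (inj₂ (refl , refl)) = refl

  ≈ₚ-swap : {a b : A} → (a , b) ≈ₚ (b , a)
  ≈ₚ-swap = inj₂ (refl , refl)

-- Degrees as neighbour counts, and the maximum degree.

module _ (G : Graph) where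
  open Graph G hiding (V; _≟_)

  ∈-vertices : ∀ v → v ∈ vertices
  ∈-vertices v =
    subst (_∈ vertices) (Inverse.strictlyInverseʳ finite v) (∈-map⁺ _ (∈-allFin (Inverse.to finite v)))

  vertices-unique : Unique vertices
  vertices-unique = map⁺ (Injection.injective (↔⇒↣ (↔-sym finite))) (allFin⁺ order)

  module _ (v : V G) where

    neighbour : Fin (degree v) → V G
    neighbour = lookup (filter (adj? v) vertices)

    neighbour-adj : ∀ i → Adj v (neighbour i)
    neighbour-adj i = proj₂ (∈-filter⁻ (adj? v) {xs = vertices} (∈-lookup i))

    neighbour-injective : Injective _≡_ _≡_ neighbour
    neighbour-injective = Unique⇒lookup-injective (filter⁺ (adj? v) vertices-unique)

    -- Each `g i` occurs in the list of neighbours of `v`, and its position there determines it, so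
    -- the positions embed `Fin n` into `Fin (degree v)`.
    injective⇒≤degree : ∀ {n} {g : Fin n → V G} →
                        Injective _≡_ _≡_ g → (∀ i → Adj v (g i)) → n ≤ degree v
    injective⇒≤degree {g = g} g-inj g-adj =
      injective⇒≤ λ eq → g-inj (index-injective (setoid _) (g∈ _) (g∈ _) eq)
      where
      g∈ : ∀ i → g i ∈ _
      g∈ i = ∈-filter⁺ (adj? v) (∈-vertices (g i)) (g-adj i)

  degree≤Δ : ∀ v → degree v ≤ Δ G
  degree≤Δ v = All.lookup (xs≤max 0 _) (∈-map⁺ degree (∈-vertices v))

  Δ< : ∀ {k} → V G → (∀ v → degree v < k) → Δ G < k
  -- The default value 0 of the maximum must also lie below `k`; the vertex `v` ensures this.
  Δ< v deg<k = max<v⁺ (≤-trans (s≤s z≤n) (deg<k v)) (All.map⁺ (All.universal deg<k vertices))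

-- Degrees in the prism `G □ K 2`.

rung : (G : Graph) (v : V G) (a : Fin 2) → Graph.Adj (G □ K 2) (v , a) (v , opposite a)
rung G v zero       = inj₂ (refl , λ ())
rung G v (suc zero) = inj₂ (refl , λ ())

-- The far end of the rung and the neighbours in layer `a` are told apart by their first coordinates
-- alone, since `v` is not its own neighbour.
degree-□K₂ : (G : Graph) (v : V G) (a : Fin 2) →
             suc (Graph.degree G v) ≤ Graph.degree (G □ K 2) (v , a)
degree-□K₂ G v a = injective⇒≤degree (G □ K 2) (v , a) {g = g} g-inj g-adj
  where
  open Graph G using (degree; adj-irrefl)

  g : Fin (suc (degree v)) → V G × Fin 2
  g zero    = v , opposite a
  g (suc i) = neighbour G v i , a

  neighbour≢v : ∀ i → v ≢ neighbour G v i
  neighbour≢v i eq = adj-irrefl eq (neighbour-adj G v i)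

  g-inj : Injective _≡_ _≡_ g
  g-inj {zero}  {zero}  _  = refl
  g-inj {zero}  {suc j} eq = contradiction (,-injectiveˡ eq) (neighbour≢v j)
  g-inj {suc i} {zero}  eq = contradiction (sym (,-injectiveˡ eq)) (neighbour≢v i)
  g-inj {suc i} {suc j} eq = cong suc (neighbour-injective G v (,-injectiveˡ eq))

  g-adj : ∀ i → Graph.Adj (G □ K 2) (v , a) (g i)
  g-adj zero    = rung G v a
  g-adj (suc i) = inj₁ (neighbour-adj G v i , refl)

-- Incidence colourings: construction from a vertex colouring, and the lower bound.

module _ {G : Graph} where
  open Graph G using (Adj; adj-sym; adj-irrefl)
  open Edge
  open Incidence
  open IncidenceColoring using (color; proper)

  -- Turns an incidence into the arc from `vertex i` to `otherEnd i`; up to `_≈ᵢ_`, incidences and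
  -- arcs carry the same information.
  otherEnd : Incidence G → V G
  otherEnd record { edge = e ; incident = inj₁ _ } = proj₂ (ends e)
  otherEnd record { edge = e ; incident = inj₂ _ } = proj₁ (ends e)

  vertex-otherEnd-adj : ∀ i → Adj (vertex i) (otherEnd i)
  vertex-otherEnd-adj record { edge = e ; incident = inj₁ refl } = adjacent e
  vertex-otherEnd-adj record { edge = e ; incident = inj₂ refl } = adj-sym (adjacent e)

  vertex-otherEnd-ends : ∀ i → (vertex i , otherEnd i) ≈ₚ ends (edge i)
  vertex-otherEnd-ends record { incident = inj₁ refl } = inj₁ (refl , refl)
  vertex-otherEnd-ends record { incident = inj₂ refl } = inj₂ (refl , refl)

  ≈ₑ⇒otherEnd : ∀ i j → edge i ≈ₑ edge j → (vertex i , otherEnd i) ≈ₚ (vertex j , otherEnd j)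
  ≈ₑ⇒otherEnd i j e≈f =
    ≈ₚ-trans (vertex-otherEnd-ends i) (≈ₚ-trans e≈f (≈ₚ-sym (vertex-otherEnd-ends j)))

  otherEnd⇒≈ᵢ : ∀ i j → vertex i ≡ vertex j → otherEnd i ≡ otherEnd j → i ≈ᵢ j
  otherEnd⇒≈ᵢ i j v≡w u≡x =
    v≡w , ≈ₚ-trans (≈ₚ-sym (vertex-otherEnd-ends i)) (≈ₚ-trans (inj₁ (v≡w , u≡x)) (vertex-otherEnd-ends j))

  ≈ᵢ⇒otherEnd : ∀ i j → i ≈ᵢ j → otherEnd i ≡ otherEnd j
  ≈ᵢ⇒otherEnd i j (v≡w , e≈f) =
    ≈ₚ-cancelˡ (subst (λ w → (vertex i , otherEnd i) ≈ₚ (w , otherEnd j)) (sym v≡w) (≈ₑ⇒otherEnd i j e≈f))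

  -- The two hypotheses say together that `c` is rainbow on closed neighbourhoods. The other ends of
  -- two adjacent incidences are either distinct neighbours of a common vertex, handled by `inj`, or
  -- adjacent to each other, handled by `hom`.
  rainbow⇒incidenceColoring : ∀ {k} (c : V G → Fin k) →
    IsHomomorphism G (K k) c → LocallyInjective G (K k) c → IncidenceColoring G k
  rainbow⇒incidenceColoring c hom inj = record
    { color  = c ∘ otherEnd
    ; cong   = λ {i} {j} i≈j → cong c (≈ᵢ⇒otherEnd i j i≈j)
    ; proper = λ {i} {j} → proper′ i j
    }
    where
    proper′ : ∀ i j → AdjacentIncidences i j → c (otherEnd i) ≢ c (otherEnd j)
    proper′ i j (i≉j , inj₁ v≡w) eq =
      i≉j (otherEnd⇒≈ᵢ i j v≡w
        (inj (vertex i) (vertex-otherEnd-adj i)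
          (subst (λ v → Adj v (otherEnd j)) (sym v≡w) (vertex-otherEnd-adj j)) eq))
    proper′ i j (i≉j , inj₂ (inj₁ e≈f)) eq with ≈ₑ⇒otherEnd i j e≈f
    ... | inj₁ (v≡w , u≡x) = i≉j (otherEnd⇒≈ᵢ i j v≡w u≡x)
    ... | inj₂ (v≡x , _)   = hom (vertex-otherEnd-adj i) (trans (cong c v≡x) (sym eq))
    -- Here the arc of `i` ends where the arc of `j` starts, so the other ends of `i` and `j` are
    -- the two ends of the edge of `j`.
    proper′ i j (_ , inj₂ (inj₂ (inj₁ vw≈e))) eq =
      hom (vertex-otherEnd-adj j) (trans (cong c w≡u) eq)
      where
      w≡u : vertex j ≡ otherEnd i
      w≡u = ≈ₚ-cancelˡ (≈ₚ-trans vw≈e (≈ₚ-sym (vertex-otherEnd-ends i)))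
    proper′ i j (_ , inj₂ (inj₂ (inj₂ vw≈f))) eq =
      hom (vertex-otherEnd-adj i) (trans (cong c v≡x) (sym eq))
      where
      v≡x : vertex i ≡ otherEnd j
      v≡x = ≈ₚ-cancelˡ (≈ₚ-trans ≈ₚ-swap (≈ₚ-trans vw≈f (≈ₚ-sym (vertex-otherEnd-ends j))))

  weakenColors : ∀ {k m} → k ≤ m → IncidenceColoring G k → IncidenceColoring G m
  weakenColors k≤m C = record
    { color  = λ i → inject≤ (color C i) k≤m
    ; cong   = λ i≈j → cong (λ c → inject≤ c k≤m) (IncidenceColoring.cong C i≈j)
    ; proper = λ adj eq → proper C adj (inject≤-injective k≤m k≤m _ _ eq)
    }

  incidence : ∀ {v u} → Adj v u → Incidence G
  incidence {v} {u} vu = record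
    { vertex   = v
    ; edge     = record { ends = v , u ; adjacent = vu }
    ; incident = inj₁ refl
    }

  degree<colors : ∀ {m u} → IncidenceColoring G m → ∀ v → Adj v u → Graph.degree G v < m
  degree<colors {m} {u} C v vu = injective⇒≤ {f = g} g-inj
    where
    entering : Incidence G
    entering = incidence (adj-sym vu)

    leaving : Fin (Graph.degree G v) → Incidence G
    leaving i = incidence (neighbour-adj G v i)

    g : Fin (suc (Graph.degree G v)) → Fin m
    g zero    = color C entering
    g (suc i) = color C (leaving i)

    entering≢leaving : ∀ i → g zero ≢ g (suc i)
    -- The vertices of the two incidences are `u` and `v`, which are the ends of the edge of
    -- `entering`, whichever edge `leaving i` uses.
    entering≢leaving i = proper C
      ((λ (u≡v , _) → adj-irrefl (sym u≡v) vu) , inj₂ (inj₂ (inj₁ (inj₁ (refl , refl)))))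

    g-inj : Injective _≡_ _≡_ g
    g-inj {zero}  {zero}  _  = refl
    g-inj {zero}  {suc j} eq = contradiction eq (entering≢leaving j)
    g-inj {suc i} {zero}  eq = contradiction (sym eq) (entering≢leaving i)
    g-inj {suc i} {suc j} eq with i ≟ j
    ... | yes i≡j = cong suc i≡j
    ... | no  i≢j = contradiction eq (proper C
      ((λ (_ , e≈f) → i≢j (neighbour-injective G v (≈ₚ-cancelˡ e≈f))) , inj₁ refl))

-- The rainbow colouring of the prism.

≢-≢⇒≡ : {a b c : Fin 2} → a ≢ b → a ≢ c → b ≡ c
≢-≢⇒≡ {_}        {zero}     {zero}     _   _   = refl
≢-≢⇒≡ {_}        {suc zero} {suc zero} _   _   = refl
≢-≢⇒≡ {zero}     {zero}     {suc zero} a≢b _   = contradiction refl a≢b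
≢-≢⇒≡ {suc zero} {zero}     {suc zero} _   a≢c = contradiction refl a≢c
≢-≢⇒≡ {zero}     {suc zero} {zero}     _   a≢c = contradiction refl a≢c
≢-≢⇒≡ {suc zero} {suc zero} {zero}     a≢b _   = contradiction refl a≢b

-- Addition modulo 2, hence injective in each argument. With a layer as first argument, layer 1
-- exchanges the two ends of a matching edge.
flip : Fin 2 → Fin 2 → Fin 2
flip zero       b = b
flip (suc zero) b = opposite b

flip-injectiveʳ : ∀ a {b c} → flip a b ≡ flip a c → b ≡ c
flip-injectiveʳ zero       eq = eq
flip-injectiveʳ (suc zero) {zero}     {zero}     _ = refl
flip-injectiveʳ (suc zero) {suc zero} {suc zero} _ = refl
flip-injectiveʳ (suc zero) {zero}     {suc zero} ()
flip-injectiveʳ (suc zero) {suc zero} {zero}     ()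

flip-injectiveˡ : ∀ {a b} c → flip a c ≡ flip b c → a ≡ b
flip-injectiveˡ {zero}     {zero}     _          _ = refl
flip-injectiveˡ {suc zero} {suc zero} _          _ = refl
flip-injectiveˡ {zero}     {suc zero} zero       ()
flip-injectiveˡ {zero}     {suc zero} (suc zero) ()
flip-injectiveˡ {suc zero} {zero}     zero       ()
flip-injectiveˡ {suc zero} {zero}     (suc zero) ()

module _ (G : Graph) {n : ℕ} (f : V G → Fin n × Fin 2)
         (hom : IsHomomorphism G (K⁻2* n) f) (inj : LocallyInjective G (K⁻2* n) f) where
  open Graph G using (Adj)

  prismColor : V G × Fin 2 → Fin (n * 2)
  prismColor (v , a) = combine (proj₁ (f v)) (flip a (proj₂ (f v)))

  prismColor-injective : ∀ u v a b → prismColor (u , a) ≡ prismColor (v , b) →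
                         proj₁ (f u) ≡ proj₁ (f v) × flip a (proj₂ (f u)) ≡ flip b (proj₂ (f v))
  prismColor-injective _ _ _ _ = combine-injective _ _ _ _

  prismColor-layer : ∀ {u v} a → prismColor (u , a) ≡ prismColor (v , a) → f u ≡ f v
  prismColor-layer {u} {v} a eq with prismColor-injective u v a a eq
  ... | i≡j , eq′ = ×-≡,≡→≡ (i≡j , flip-injectiveʳ a eq′)

  prismColor-rung : ∀ v {a b} → a ≢ b → prismColor (v , a) ≢ prismColor (v , b)
  prismColor-rung v {a} {b} a≢b eq =
    a≢b (flip-injectiveˡ (proj₂ (f v)) (proj₂ (prismColor-injective v v a b eq)))

  -- Equal colours in different layers would make `f u` and `f v` matching partners, but `hom` makes
  -- them adjacent in `K⁻2* n`.
  prismColor-cross : ∀ {v u a b} → Adj v u → a ≢ b → prismColor (u , a) ≢ prismColor (v , b)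
  prismColor-cross {v} {u} {a} {b} vu a≢b eq with prismColor-injective u v a b eq
  ... | i≡j , eq′ = proj₂ (hom vu)
    (sym i≡j , λ p≡q → a≢b (flip-injectiveˡ (proj₂ (f u)) (trans eq′ (cong (flip b) p≡q))))

  prismColor-hom : IsHomomorphism (G □ K 2) (K (n * 2)) prismColor
  prismColor-hom {_ , a} (inj₁ (vu , refl))  eq = proj₁ (hom vu) (prismColor-layer a eq)
  prismColor-hom {v , _} (inj₂ (refl , a≢b)) eq = prismColor-rung v a≢b eq

  -- Two neighbours in the same layer are separated by `inj`, one in the layer and one across the
  -- rung by `prismColor-cross`; only one neighbour lies across the rung.
  prismColor-locallyInjective : LocallyInjective (G □ K 2) (K (n * 2)) prismColor
  prismColor-locallyInjective (v , a) (inj₁ (vu , refl)) (inj₁ (vw , refl)) eq =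
    cong (_, a) (inj v vu vw (prismColor-layer a eq))
  prismColor-locallyInjective _ (inj₁ (vu , refl)) (inj₂ (refl , a≢b)) eq =
    contradiction eq (prismColor-cross vu a≢b)
  prismColor-locallyInjective _ (inj₂ (refl , a≢b)) (inj₁ (vw , refl)) eq =
    contradiction (sym eq) (prismColor-cross vw a≢b)
  prismColor-locallyInjective (v , _) (inj₂ (refl , a≢b)) (inj₂ (refl , a≢c)) _ =
    cong (v ,_) (≢-≢⇒≡ a≢b a≢c)

mainTheorem7 : (G : Graph) → TwoPermutable G → IsIncidenceChromaticNumber (G □ K 2) (Δ (G □ K 2) + 1)
mainTheorem7 G (d , (v₀ , _) , regular , f , hom , inj) =
    weakenColors enough (rainbow⇒incidenceColoring (prismColor G f hom inj)
      (prismColor-hom G f hom inj) (prismColor-locallyInjective G f hom inj))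
  , λ m C → begin
      Δ (G □ K 2) + 1   ≡⟨ +-comm _ 1 ⟩
      -- The rung at each vertex supplies the incidence entering it.
      suc (Δ (G □ K 2)) ≤⟨ Δ< (G □ K 2) (v₀ , zero) (λ (v , a) → degree<colors C (v , a) (rung G v a)) ⟩
      m                 ∎
  where
  open ≤-Reasoning

  -- The colours are the `2d + 2` vertices of `K⁻2* (suc d)`; the vertex `(v₀ , zero)` has at least
  -- `2d` neighbours in its layer and one across the rung.
  enough : suc d * 2 ≤ Δ (G □ K 2) + 1
  enough = begin
    suc d * 2                                       ≡⟨ cong (2 +_) (*-comm d 2) ⟩
    2 + 2 * d                                       ≡⟨ cong (2 +_) (sym (regular v₀)) ⟩
    suc (suc (Graph.degree G v₀))                   ≤⟨ s≤s (degree-□K₂ G v₀ zero) ⟩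
    suc (Graph.degree (G □ K 2) (v₀ , zero))        ≤⟨ s≤s (degree≤Δ (G □ K 2) (v₀ , zero)) ⟩
    suc (Δ (G □ K 2))                               ≡⟨ +-comm 1 _ ⟩
    Δ (G □ K 2) + 1                                 ∎
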